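{- The running time of a sequence of pairing heap operations on an initially empty collection of heaps is $O(1)$ per insertion, zero per meld, and $O(\log n)$ per $\mathit{decrease\text{ - }key}$ and deletion, in the amortized sense: there is an absolute constant $c$ such that for every finite sequence of operations the total running time is at most $$c\left(I+F+\sum_{\sigma} \log n_\sigma\right),$$ where $I$ is the number of $\mathit{insert}$ operations, $F$ is the total number of $\mathit{make\text{ - }heap}$ and $\mathit{find\text{ - }min}$ operations, the sum ranges over the $\mathit{decrease\text{ - }key}$ operations and the deletions in the sequence, and $n_\sigma=\max\{4,\text{number of temporary nodes in the heap undergoing } \sigma \text{ just before } \sigma\}$.
   Context: A pairing heap stores the items of a heap (each with a key from a totally ordered set) as the nodes of an ordered rooted tree that is heap-ordered: a parent's key is at most the key of each of its children. A link of the roots of two node-disjoint heap-ordered trees makes the root of smaller key (the winner; ties broken arbitrarily) the parent of the other root (the loser), the loser becoming the new leftmost child of the winner. A cut of a link breaks it, detaching the loser together with its subtree. Operations: $\mathit{make\text{ - }heap}()$ creates an empty tree. $\mathit{find\text{ - }min}(H)$ returns the root. $\mathit{insert}(H,x)$ makes $x$ (a new node) a one-node tree; if $H$ is non-empty it links $x$ with the root of $H$, otherwise $x$ becomes the root. $\mathit{meld}(H_1,H_2)$, for item-disjoint heaps, returns the other heap if one is empty, and otherwise links the two roots; $H_1,H_2$ are destroyed and replaced by the result. $\mathit{decrease\text{ - }key}(H,x,k)$ (given the location of $x$, with $k$ at most the key of $x$) sets the key of $x$ to $k$ and, if $x$ is not the root, cuts the link lost by $x$ and links $x$ with the root. $\mathit{delete\text{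 - }min}(H)$ ("deletion") removes the root of $H$; if other nodes exist, it cuts all links between the root and its children, making the left-to-right list of children a list of roots, and links them in two passes: the pairing pass links the roots in pairs left to right (first with second, third with fourth, and so on; with an odd number the last is not linked), the winner of each link taking the pair's place on the list; the assembly pass then repeatedly links the current rightmost root with its left neighbor until one root remains. Arbitrary deletion is implemented as $\mathit{decrease\text{ - }key}$ to $-\infty$ followed by $\mathit{delete\text{ - }min}$. Every heap arises by $\mathit{make\text{ - }heap}$ or by $\mathit{meld}$. Cost model: the tree is represented with pointers so that each link or cut takes $O(1)$ time; each operation other than a deletion takes $O(1)$ worst-case time (and does at most one link), and a deletion takes $O(1)$ time plus $O(1)$ time per link it does. A node is temporary if it is eventually deleted during the sequence, permanent if not. -}

module Defs where

open import Data.List using (List; []; _∷_; _++_; length; filter)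
open import Data.List.Membership.Propositional using (_∈_)
open import Data.List.Membership.DecPropositional using () renaming (_∈?_ to mem?)
open import Data.List.Relation.Binary.Permutation.Propositional using (_↭_)
open import Data.Maybe using (Maybe; nothing; just)
open import Data.Nat using (ℕ; suc; _+_; _*_; _⊔_; _≤_)
open import Data.Nat.Logarithm using (⌊log₂_⌋)
open import Data.Nat.Properties using (_≟_)
open import Level using () renaming (_⊔_ to _⊔ˡ_)
open import Relation.Binary.Bundles using (TotalOrder)
open import Relation.Binary.Construct.Closure.ReflexiveTransitive using (Star; ε; _◅_)
open import Relation.Nullary using (Dec)

Node : Set
Node = ℕ

-- Operations are relations rather than functions because ties between keys
-- may be broken arbitrarily, differently at each link.

module PairingHeap {a ℓ₁ ℓ₂} (O : TotalOrder a ℓ₁ ℓ₂) where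

  open TotalOrder O using () renaming (Carrier to Key; _≤_ to _≼_)

  -- Children are listed from left to right.  Heap order is not a field: it
  -- holds in every tree that the operations below build from nothing.
  data Tree : Set a where
    node : (x : Node) (k : Key) (cs : List Tree) → Tree

  Heap : Set a
  Heap = Maybe Tree

  mutual
    nodes : Tree → List Node
    nodes (node x _ cs) = x ∷ nodes* cs

    nodes* : List Tree → List Node
    nodes* []       = []
    nodes* (t ∷ ts) = nodes t ++ nodes* ts

  data Link : Tree → Tree → Tree → Set (a ⊔ˡ ℓ₂) where
    winˡ : ∀ {x k cs y l ds} → k ≼ l →
           Link (node x k cs) (node y l ds) (node x k (node y l ds ∷ cs))
    winʳ : ∀ {x k cs y l ds} → l ≼ k →
           Link (node x k cs) (node y l ds) (node y l (node x k cs ∷ ds))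

  -- Cut t s t′: cutting the link lost by the root of s, a proper subtree
  -- of t, splits t into s and t′.
  data Cut : Tree → Tree → Tree → Set a where
    child  : ∀ {x k} ls {s} rs →
             Cut (node x k (ls ++ s ∷ rs)) s (node x k (ls ++ rs))
    deeper : ∀ {x k} ls {t s t′} rs → Cut t s t′ →
             Cut (node x k (ls ++ t ∷ rs)) s (node x k (ls ++ t′ ∷ rs))

  data Meld : Heap → Heap → Heap → Set (a ⊔ˡ ℓ₂) where
    emptyˡ : ∀ {h} → Meld nothing h h
    emptyʳ : ∀ {h} → Meld h nothing h
    link   : ∀ {t u v} → Link t u v → Meld (just t) (just u) (just v)

  data DecreaseKey : Tree → Tree → Set (a ⊔ˡ ℓ₂) where
    root    : ∀ {x k k′ cs} → k′ ≼ k →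
              DecreaseKey (node x k cs) (node x k′ cs)
    nonroot : ∀ {t x k k′ cs t′ u} → Cut t (node x k cs) t′ → k′ ≼ k →
              Link (node x k′ cs) t′ u → DecreaseKey t u

  -- In the next three relations the natural number counts the links done.

  data PairingPass : List Tree → List Tree → ℕ → Set (a ⊔ˡ ℓ₂) where
    none : PairingPass [] [] 0
    last : ∀ {t} → PairingPass (t ∷ []) (t ∷ []) 0
    pair : ∀ {t u v ts us n} → Link t u v → PairingPass ts us n →
           PairingPass (t ∷ u ∷ ts) (v ∷ us) (suc n)

  -- Linking from right to left, a root is linked once all the roots to its
  -- right have been combined into one tree.
  data AssemblyPass : List Tree → Tree → ℕ → Set (a ⊔ˡ ℓ₂) where
    done : ∀ {t} → AssemblyPass (t ∷ []) t 0
    step : ∀ {t ts u v n} → AssemblyPass ts u n → Link t u v →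
           AssemblyPass (t ∷ ts) v (suc n)

  data Combine : List Tree → Heap → ℕ → Set (a ⊔ˡ ℓ₂) where
    empty   : Combine [] nothing 0
    twoPass : ∀ {ts us t m n} → PairingPass ts us m → AssemblyPass us t n →
              Combine ts (just t) (m + n)

  -- Nodes are numbered in order of insertion, and fresh is the next number,
  -- so that an inserted node differs from all earlier ones, deleted or not.
  record State : Set a where
    constructor ⟨_,_⟩
    field
      fresh : ℕ
      heaps : List Heap

  initial : State
  initial = ⟨ 0 , [] ⟩

  -- The order of the collection is immaterial: a permutation brings the
  -- heaps operated on to the front.  Deleting an arbitrary node is a
  -- decreaseKey to a least key followed by a deleteMin, a least key being
  -- available in Relation.Binary.Construct.Add.Infimum.NonStrict.
  data Step : State → State → Set (a ⊔ˡ ℓ₂) where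
    makeHeap    : ∀ {f hs} → Step ⟨ f , hs ⟩ ⟨ f , nothing ∷ hs ⟩
    findMin     : ∀ {f hs h} → h ∈ hs → Step ⟨ f , hs ⟩ ⟨ f , hs ⟩
    insert      : ∀ {f hs h h′ hs′} (k : Key) → hs ↭ h ∷ hs′ →
                  Meld (just (node f k [])) h h′ →
                  Step ⟨ f , hs ⟩ ⟨ suc f , h′ ∷ hs′ ⟩
    meld        : ∀ {f hs h₁ h₂ h hs′} → hs ↭ h₁ ∷ h₂ ∷ hs′ →
                  Meld h₁ h₂ h → Step ⟨ f , hs ⟩ ⟨ f , h ∷ hs′ ⟩
    decreaseKey : ∀ {f hs t t′ hs′} → hs ↭ just t ∷ hs′ →
                  DecreaseKey t t′ → Step ⟨ f , hs ⟩ ⟨ f , just t′ ∷ hs′ ⟩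
    deleteMin   : ∀ {f hs x k cs h n hs′} →
                  hs ↭ just (node x k cs) ∷ hs′ → Combine cs h n →
                  Step ⟨ f , hs ⟩ ⟨ f , h ∷ hs′ ⟩

  Execution : State → State → Set (a ⊔ˡ ℓ₂)
  Execution = Star Step

  total : (∀ {s s′} → Step s s′ → ℕ) → ∀ {s s′} → Execution s s′ → ℕ
  total f ε        = 0
  total f (σ ◅ σs) = f σ + total f σs

  maxTime : ℕ → ∀ {s s′} → Step s s′ → ℕ
  maxTime b (deleteMin {n = n} _ _) = b + b * n
  maxTime b _                       = b

  -- b bounds all the O(1) terms of the cost model.
  CostModel : ℕ → (∀ {s s′} → Step s s′ → ℕ) → Set (a ⊔ˡ ℓ₂)
  CostModel b time = ∀ {s s′} (σ : Step s s′) → time σ ≤ maxTime b σ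

  isInsert : ∀ {s s′} → Step s s′ → ℕ
  isInsert (insert _ _ _) = 1
  isInsert _              = 0

  isMakeHeapOrFindMin : ∀ {s s′} → Step s s′ → ℕ
  isMakeHeapOrFindMin makeHeap    = 1
  isMakeHeapOrFindMin (findMin _) = 1
  isMakeHeapOrFindMin _           = 0

  deleted : ∀ {s s′} → Execution s s′ → List Node
  deleted ε                            = []
  deleted (deleteMin {x = x} _ _ ◅ σs) = x ∷ deleted σs
  deleted (_ ◅ σs)                     = deleted σs

  Temporary : ∀ {s s′} → Execution s s′ → Node → Set
  Temporary σs x = x ∈ deleted σs

  temporary? : ∀ {s s′} (σs : Execution s s′) (x : Node) →
               Dec (Temporary σs x)
  temporary? σs x = mem? _≟_ x (deleted σs)

  size : ∀ {s s′} → Execution s s′ → Tree → ℕ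
  size σs t = 4 ⊔ length (filter (temporary? σs) (nodes t))

  -- σs is the whole sequence, of which the step is a member.  As size is at
  -- least 4, rounding log₂ down changes it by less than a factor of 2.
  logSize : ∀ {s s′} → Execution s s′ → ∀ {r r′} → Step r r′ → ℕ
  logSize σs (decreaseKey {t = t} _ _)                 =
    ⌊log₂ size σs t ⌋
  logSize σs (deleteMin {x = x} {k = k} {cs = cs} _ _) =
    ⌊log₂ size σs (node x k cs) ⌋
  logSize σs _                                         = 0

{-# OPTIONS --safe #-}

-- Write lg for ⌊log₂_⌋ and let the size of a tree be its number of temporary
-- nodes.  Only deletions cost more than O(1), and a node that is deleted is
-- temporary, so only children of temporary nodes carry potential.  A temporary
-- child has 8 times the lg of the size of its subtree and of those of the
-- siblings to its right.  As usual for pairing heaps, concavity of the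
-- logarithm pays for the pairing links between temporary nodes, up to
-- O(log n).  A permanent child has constant potential, released for good (up
-- to a decrease-key) when it loses to a permanent node.
--
-- This leaves the pairing links in which a permanent node loses to a temporary
-- one.  A temporary child whose right neighbour is permanent therefore has an
-- extra potential of 4 if its subtree is no larger than those to its right
-- together, as is the case for all but O(log n) of the roots in a list.  The
-- assembly pass makes such neighbours again only by letting a champion win
-- over the previous one, which lies in a subtree larger than what is then to
-- its right, with O(log n) exceptions.  A decrease-key changes the comparison
-- of sizes only for O(log n) ancestors of the node that is cut.
--
-- Finally, the sum of lg i for i ≤ size is superadditive.  Since no temporary
-- node is left at the end, this turns the O(log n) potential created by
-- insertions and melds into a charge to the deletions.

module Submission where

open import Data.Bool using (Bool; true; false; not; if_then_else_)
open import Data.Empty using (⊥-elim)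
open import Data.List using (List; []; _∷_; _++_; length; filter; map)
open import Data.List.Membership.Propositional using (_∈_)
open import Data.List.Properties using (filter-++; length-++)
open import Data.List.Relation.Binary.Permutation.Propositional using (_↭_)
open import Data.List.Relation.Binary.Permutation.Propositional.Properties using (map⁺)
open import Data.List.Relation.Unary.Any using (here; there)
open import Data.Maybe using (nothing; just)
open import Data.Nat using (ℕ; zero; suc; _+_; _*_; _≤_; _<_; _≤ᵇ_; z≤n; s≤s)
open import Data.Nat.ListAction using (sum)
open import Data.Nat.ListAction.Properties using (sum-↭)
open import Data.Nat.Logarithm using (⌊log₂_⌋; ⌊log₂⌋-mono-≤; ⌊log₂[2*b]⌋≡1+⌊log₂b⌋)
open import Data.Nat.Properties
open import Data.Nat.Tactic.RingSolver using (solve)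
open import Data.Product using (_,_; ∃-syntax)
open import Data.Sum using (_⊎_; inj₁; inj₂)
open import Relation.Binary.Bundles using (TotalOrder)
open import Relation.Binary.Construct.Closure.ReflexiveTransitive using (ε; _◅_)
open import Relation.Binary.PropositionalEquality using (_≡_; _≢_; refl; sym; trans; cong; cong₂; subst; module ≡-Reasoning)
open import Relation.Nullary using (yes; no; does; ofʸ; ofⁿ)
open import Relation.Nullary.Decidable using (dec-true; dec-false)
open import Relation.Unary using (Pred; Decidable)
open import Defs

-- Linear inequalities.

infixr 7 _⊛_
infixr 6 _⊞_

_⊛_ : ∀ k {m n} → m ≤ n → k * m ≤ k * n
k ⊛ h = *-monoʳ-≤ k h

_⊞_ : ∀ {m n m′ n′} → m ≤ n → m′ ≤ n′ → m + m′ ≤ n + n′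
_⊞_ = +-mono-≤

-- A linear inequality follows from a combination of hypotheses, summed up
-- in l ≤ r, by an identity that the ring solver can check.
combine : ∀ {x y l r} slack → l ≤ r → x + r + slack ≡ y + l → x ≤ y
combine {x} {y} {l} {r} slack l≤r eq = +-cancelʳ-≤ r x y (begin
  x + r          ≤⟨ m≤m+n (x + r) slack ⟩
  x + r + slack  ≡⟨ eq ⟩
  y + l          ≤⟨ +-monoʳ-≤ y l≤r ⟩
  y + r          ∎)
  where open ≤-Reasoning

-- The rounded logarithm and its partial sums.

-- Abstract, as ⌊log₂ suc n ⌋ would unfold.
abstract
  lg : ℕ → ℕ
  lg = ⌊log₂_⌋

  lg≡⌊log₂⌋ : ∀ n → lg n ≡ ⌊log₂ n ⌋
  lg≡⌊log₂⌋ n = refl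

  lg-1 : lg 1 ≡ 0
  lg-1 = refl

  lg-mono : ∀ {m n} → m ≤ n → lg m ≤ lg n
  lg-mono = ⌊log₂⌋-mono-≤

  lg-double : ∀ {m n} → 1 ≤ m → m + m ≤ n → 1 + lg m ≤ lg n
  lg-double {suc m} {n} _ 2m≤n = begin
    1 + lg (suc m)        ≡⟨ ⌊log₂[2*b]⌋≡1+⌊log₂b⌋ (suc m) ⟨
    lg (2 * suc m)        ≡⟨ cong (λ k → lg (suc m + k)) (+-identityʳ (suc m)) ⟩
    lg (suc m + suc m)    ≤⟨ lg-mono 2m≤n ⟩
    lg n                  ∎
    where open ≤-Reasoning

1≤lg : ∀ {n} → 2 ≤ n → 1 ≤ lg n
1≤lg {n} 2≤n = subst (λ k → 1 + k ≤ lg n) lg-1 (lg-double ≤-refl 2≤n)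

-- The smaller argument is at most half of the sum, so its logarithm grows by at least 1 on passing
-- to the sum.
lg-concave : ∀ {m n} → 1 ≤ m → 1 ≤ n → 1 + (lg m + lg n) ≤ 2 * lg (m + n)
lg-concave {m} {n} 1≤m 1≤n with ≤-total m n
... | inj₁ m≤n = ineq (lg m) (lg n) (lg (m + n))
    (lg-double 1≤m (+-monoʳ-≤ m m≤n)) (lg-mono (m≤n+m n m))
  where
  ineq : ∀ x y z → 1 + x ≤ z → y ≤ z → 1 + (x + y) ≤ 2 * z
  ineq x y z h₁ h₂ = combine 0 (h₁ ⊞ h₂) (solve (x ∷ y ∷ z ∷ []))
... | inj₂ n≤m = ineq (lg m) (lg n) (lg (m + n))
    (lg-mono (m≤m+n m n)) (lg-double 1≤n (+-monoˡ-≤ n n≤m))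
  where
  ineq : ∀ x y z → x ≤ z → 1 + y ≤ z → 1 + (x + y) ≤ 2 * z
  ineq x y z h₁ h₂ = combine 0 (h₁ ⊞ h₂) (solve (x ∷ y ∷ z ∷ []))

lgFactorial : ℕ → ℕ
lgFactorial zero    = 0
lgFactorial (suc n) = lg (suc n) + lgFactorial n

lgFactorial-+ : ∀ m n → lgFactorial m + lgFactorial n ≤ lgFactorial (m + n)
lgFactorial-+ zero    n = ≤-refl
lgFactorial-+ (suc m) n = ≤-trans
  (≤-reflexive (+-assoc (lg (suc m)) (lgFactorial m) (lgFactorial n)))
  (+-mono-≤ (lg-mono (m≤m+n (suc m) n)) (lgFactorial-+ m n))

-- Once the top term is split off, one index fewer is left for the two sums, but the first of them
-- can give up `lg 1`, which is 0. Its terms from index 2 on fit above the `n` terms of the other.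
lgFactorial-+⁺ : ∀ m n → 1 ≤ m → 1 ≤ n →
  lg (m + n) + (lgFactorial m + lgFactorial n) ≤ lgFactorial (m + n)
lgFactorial-+⁺ (suc m) n _ 1≤n = +-monoʳ-≤ (lg (suc m + n)) (shifted m)
  where
  shifted : ∀ m → lgFactorial (suc m) + lgFactorial n ≤ lgFactorial (m + n)
  shifted zero    = ≤-reflexive (cong (λ k → k + 0 + lgFactorial n) lg-1)
  shifted (suc m) = ≤-trans
    (≤-reflexive (+-assoc (lg (2 + m)) (lgFactorial (suc m)) (lgFactorial n)))
    (+-mono-≤ (lg-mono (s≤s (≤-trans (≤-reflexive (+-comm 1 m)) (+-monoʳ-≤ m 1≤n))))
              (shifted m))

-- The potential of a single child.

bit : Bool → ℕ
bit true  = 1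
bit false = 0

-- The extra potential of a temporary child of size s whose right siblings have
-- total size w; the Bool tells whether its right neighbour is permanent.
light : Bool → ℕ → ℕ → ℕ
light false s w = 0
light true  s w = if s ≤ᵇ w then 4 else 0

light≤4 : ∀ p s w → light p s w ≤ 4
light≤4 false s w = z≤n
light≤4 true  s w with s ≤ᵇ w | ≤ᵇ-reflects-≤ s w
... | true  | _ = ≤-refl
... | false | _ = z≤n

light-mono : ∀ p s {w w′} → w ≤ w′ → light p s w ≤ light p s w′
light-mono false s _ = z≤n
light-mono true  s {w} {w′} w≤w′ with s ≤ᵇ w | ≤ᵇ-reflects-≤ s w | s ≤ᵇ w′ | ≤ᵇ-reflects-≤ s w′
... | true  | _       | true  | _ = ≤-refl
... | true  | ofʸ s≤w | false | ofⁿ s≰w′ = ⊥-elim (s≰w′ (≤-trans s≤w w≤w′))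
... | false | _       | _     | _ = z≤n

-- Extra potential is present only if `s ≤ w`. Then `n` is at least twice `m`, and 4 times the gain
-- of 1 in the logarithm covers it.
light-upper : ∀ p s w {m n} → 1 ≤ m → m ≤ n → (s ≤ w → m + m ≤ n) →
  light p s w + 4 * lg m ≤ 4 * lg n
light-upper false s w _ m≤n _ = 4 ⊛ lg-mono m≤n
light-upper true  s w {m} {n} 1≤m m≤n double with s ≤ᵇ w | ≤ᵇ-reflects-≤ s w
... | false | _       = 4 ⊛ lg-mono m≤n
... | true  | ofʸ s≤w = ineq (lg m) (lg n) (lg-double 1≤m (double s≤w))
  where
  ineq : ∀ x y → 1 + x ≤ y → 4 + 4 * x ≤ 4 * y
  ineq x y h = combine 0 (4 ⊛ h) (solve (x ∷ y ∷ []))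

-- Dual to `light-upper`: where the extra potential is missing, doubling supplies the same 4.
light-lower : ∀ s w {m n} → 1 ≤ m → m ≤ n → (w < s → m + m ≤ n) →
  4 + 4 * lg m ≤ light true s w + 4 * lg n
light-lower s w {m} {n} 1≤m m≤n double with s ≤ᵇ w | ≤ᵇ-reflects-≤ s w
... | true  | _ = +-monoʳ-≤ 4 (4 ⊛ lg-mono m≤n)
... | false | ofⁿ s≰w = ineq (lg m) (lg n) (lg-double 1≤m (double (≰⇒> s≰w)))
  where
  ineq : ∀ x y → 1 + x ≤ y → 4 + 4 * x ≤ 4 * y
  ineq x y h = combine 0 (4 ⊛ h) (solve (x ∷ y ∷ []))

-- The potential of a child of a temporary node.  b and s tell whether the
-- child is temporary and the size of its subtree, p whether its right
-- neighbour is permanent, and w the total size of its right siblings.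
childPotential : Bool → ℕ → Bool → ℕ → ℕ
childPotential false s p w = 6
childPotential true  s p w = 8 * lg (1 + (s + w)) + light p s w

-- A smaller subtree may become light and gain 4. This needs `s ≤ w`, so `lg (s + w)` exceeds `lg s`
-- by at least 1. Chained along a path, the logarithms telescope.
childPotential-shrink : ∀ b {s s′ w} p → bit b ≤ s → s ≤ s′ →
  childPotential b s p w + 4 * lg s ≤ childPotential b s′ p w + 4 * lg (s + w)
childPotential-shrink false {s} {w = w} p _ _ = +-monoʳ-≤ 6 (4 ⊛ lg-mono (m≤m+n s w))
childPotential-shrink true {s} {s′} {w} p 1≤s s≤s′ = ineq
    (lg (1 + (s + w))) (lg (1 + (s′ + w))) (light p s w) (light p s′ w) (lg s) (lg (s + w))
    (lg-mono (s≤s (+-monoˡ-≤ w s≤s′)))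
    (light-upper p s w 1≤s (m≤m+n s w) (+-monoʳ-≤ s))
  where
  ineq : ∀ x y l l′ u v → x ≤ y → l + 4 * u ≤ 4 * v →
    8 * x + l + 4 * u ≤ 8 * y + l′ + 4 * v
  ineq x y l l′ u v h₁ h₂ = combine l′ (8 ⊛ h₁ ⊞ h₂)
    (solve (x ∷ y ∷ l ∷ l′ ∷ u ∷ v ∷ []))

childPotential-monoʳ : ∀ b s p {w w′} → w ≤ w′ →
  childPotential b s p w ≤ childPotential b s p w′
childPotential-monoʳ false s p _ = ≤-refl
childPotential-monoʳ true s p w≤w′ =
  8 ⊛ lg-mono (s≤s (+-monoʳ-≤ s w≤w′)) ⊞ light-mono p s w≤w′

childPotential-change : ∀ b s p p′ {w w′} → w ≤ w′ →
  childPotential b s p w ≤ childPotential b s p′ w′ + 4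
childPotential-change false s p p′ _ = m≤m+n 6 4
childPotential-change true s p p′ {w} {w′} w≤w′ = +-mono-≤
  (≤-trans (8 ⊛ lg-mono (s≤s (+-monoʳ-≤ s w≤w′))) (m≤m+n _ (light p′ s w′)))
  (light≤4 p s w)

-- Single links in the two passes.

-- What a root brings along from the pairing pass into the assembly pass, where
-- w is the total size of its tree and of those to its right.
entry : Bool → ℕ → ℕ
entry true  w = 1 + 8 * lg (1 + w)
entry false w = 11

-- Set aside by a list of roots unless it starts with a permanent one, for the
-- case that the pair to the left of it is a permanent root losing to a
-- temporary one on its right: such a pair has no extra potential to release.
credit : Bool → ℕ
credit true  = 0
credit false = 2

-- A bound on the potential created by a link, given whether its arguments and
-- its winner are temporary.  Where no winner can be as described, it is 0.
linkCost : Bool → Bool → Bool → ℕ → ℕ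
linkCost true  true  true  s = 8 * lg s + 4
linkCost true  true  false s = 0
linkCost true  false true  s = 6
linkCost true  false false s = 0
linkCost false true  true  s = 6
linkCost false true  false s = 0
linkCost false false b     s = 0

-- Here `a` and `b` are the sizes of the linked trees and `c` is that of the rest of the list. The
-- terms `16 * lg` telescope over the pairs; each case has its own source of payment.
pairing-link : ∀ bt bu bv bn a b c φ φv → bv ≡ bt ⊎ bv ≡ bu →
  bit bt ≤ a → bit bu ≤ b → φv ≤ φ + linkCost bt bu bv (a + b) →
  1 + (entry bv (a + (b + c)) + φv) + credit (not bt) + 16 * lg (1 + c) ≤
  childPotential bt a (not bu) (b + c) + childPotential bu b bn c + φ +
  credit bn + 16 * lg (1 + (a + (b + c)))
-- Concavity, applied to `a + b` and `1 + c`, pays for the new child.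
pairing-link true true true bn a b c φ φv _ 1≤a 1≤b φv≤ = ineq (lg (1 + c)) (lg (1 + (b + c)))
    (lg (1 + (a + (b + c)))) (lg (a + b)) (light false a (b + c)) (light bn b c) (credit bn) φ φv
    (≤-trans (lg-concave {a + b} {1 + c} (≤-trans 1≤a (m≤m+n a b)) (s≤s z≤n))
             (≤-reflexive (cong (λ k → 2 * lg k) reorder)))
    (lg-mono (s≤s (m≤n+m c b))) φv≤
  where
  reorder : a + b + (1 + c) ≡ 1 + (a + (b + c))
  reorder = solve (a ∷ b ∷ c ∷ [])
  ineq : ∀ x y z l p q r φ φv → 1 + (l + x) ≤ 2 * z → x ≤ y → φv ≤ φ + (8 * l + 4) →
    1 + (1 + 8 * z + φv) + 2 + 16 * x ≤
    8 * z + p + (8 * y + q) + φ + r + 16 * z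
  ineq x y z l p q r φ φv h₁ h₂ h₃ = combine (p + q + r) (8 ⊛ h₁ ⊞ 8 ⊛ h₂ ⊞ h₃)
    (solve (x ∷ y ∷ z ∷ l ∷ p ∷ q ∷ r ∷ φ ∷ φv ∷ []))
-- The left root pays with its extra potential or, not being light, by doubling `1 + c`.
pairing-link true false true bn a b c φ φv _ 1≤a _ φv≤ = ineq (lg (1 + c))
    (lg (1 + (a + (b + c)))) (light true a (b + c)) (credit bn) φ φv
    (light-lower a (b + c) (s≤s z≤n) 1+c≤ double) (lg-mono 1+c≤) φv≤
  where
  1+c≤ : 1 + c ≤ 1 + (a + (b + c))
  1+c≤ = s≤s (≤-trans (m≤n+m c b) (m≤n+m (b + c) a))
  double : b + c < a → 1 + c + (1 + c) ≤ 1 + (a + (b + c))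
  double b+c<a = ≤-trans (+-mono-≤ (≤-trans (s≤s (m≤n+m c b)) b+c<a) (s≤s (m≤n+m c b)))
    (≤-reflexive (+-suc a (b + c)))
  ineq : ∀ x z p r φ φv → 4 + 4 * x ≤ p + 4 * z → x ≤ z → φv ≤ φ + 6 →
    1 + (1 + 8 * z + φv) + 2 + 16 * x ≤ 8 * z + p + 6 + φ + r + 16 * z
  ineq x z p r φ φv h₁ h₂ h₃ = combine r (h₁ ⊞ 12 ⊛ h₂ ⊞ h₃)
    (solve (x ∷ z ∷ p ∷ r ∷ φ ∷ φv ∷ []))
-- The logarithmic potential of the temporary loser is released, and it is at least 8.
pairing-link true false false bn a b c φ φv _ 1≤a _ φv≤ = ineq (lg (1 + c))
    (lg (1 + (a + (b + c)))) (light true a (b + c)) (credit bn) φ φv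
    (1≤lg (s≤s (≤-trans 1≤a (m≤m+n a (b + c)))))
    (lg-mono (s≤s (≤-trans (m≤n+m c b) (m≤n+m (b + c) a)))) φv≤
  where
  ineq : ∀ x z p r φ φv → 1 ≤ z → x ≤ z → φv ≤ φ + 0 →
    1 + (11 + φv) + 2 + 16 * x ≤ 8 * z + p + 6 + φ + r + 16 * z
  ineq x z p r φ φv h₁ h₂ h₃ = combine (p + r) (8 ⊛ h₁ ⊞ 16 ⊛ h₂ ⊞ h₃)
    (solve (x ∷ z ∷ p ∷ r ∷ φ ∷ φv ∷ []))
-- The missing 2 comes from the right root if its right neighbour is permanent, and from the credit
-- of the remaining list otherwise.
pairing-link false true true bn a b c φ φv _ _ 1≤b φv≤ = ineq (lg (1 + c)) (lg (1 + (b + c)))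
    (lg (1 + (a + (b + c)))) (light bn b c) (credit bn) φ φv
    (next bn) (lg-mono (s≤s (m≤n+m c b))) (lg-mono (s≤s (m≤n+m (b + c) a))) φv≤
  where
  double : c < b → 1 + c + (1 + c) ≤ 1 + (b + c)
  double c<b = ≤-trans (+-monoˡ-≤ (1 + c) c<b) (≤-reflexive (+-suc b c))
  next : ∀ bn → 2 + 4 * lg (1 + c) ≤ light bn b c + credit bn + 4 * lg (1 + (b + c))
  next true  = ineq′ (lg (1 + c)) (light true b c) (lg (1 + (b + c)))
      (light-lower b c (s≤s z≤n) (s≤s (m≤n+m c b)) double)
    where
    ineq′ : ∀ x p y → 4 + 4 * x ≤ p + 4 * y → 2 + 4 * x ≤ p + 0 + 4 * y
    ineq′ x p y h = combine 2 h (solve (x ∷ p ∷ y ∷ []))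
  next false = +-monoʳ-≤ 2 (4 ⊛ lg-mono (s≤s (m≤n+m c b)))
  ineq : ∀ x y z p r φ φv → 2 + 4 * x ≤ p + r + 4 * y → x ≤ y → y ≤ z → φv ≤ φ + 6 →
    1 + (1 + 8 * z + φv) + 0 + 16 * x ≤ 6 + (8 * y + p) + φ + r + 16 * z
  ineq x y z p r φ φv h₁ h₂ h₃ h₄ = combine 0 (h₁ ⊞ 12 ⊛ h₂ ⊞ 8 ⊛ h₃ ⊞ h₄)
    (solve (x ∷ y ∷ z ∷ p ∷ r ∷ φ ∷ φv ∷ []))
pairing-link false true false bn a b c φ φv _ _ 1≤b φv≤ = ineq (lg (1 + c)) (lg (1 + (b + c)))
    (lg (1 + (a + (b + c)))) (light bn b c) (credit bn) φ φv
    (1≤lg (s≤s (≤-trans 1≤b (m≤m+n b c))))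
    (lg-mono (s≤s (≤-trans (m≤n+m c b) (m≤n+m (b + c) a)))) φv≤
  where
  ineq : ∀ x y z p r φ φv → 1 ≤ y → x ≤ z → φv ≤ φ + 0 →
    1 + (11 + φv) + 0 + 16 * x ≤ 6 + (8 * y + p) + φ + r + 16 * z
  ineq x y z p r φ φv h₁ h₂ h₃ = combine (p + r + 2) (8 ⊛ h₁ ⊞ 16 ⊛ h₂ ⊞ h₃)
    (solve (x ∷ y ∷ z ∷ p ∷ r ∷ φ ∷ φv ∷ []))
-- The two potentials of 6 make up exactly 1 for the link and 11 for the winner's entry.
pairing-link false false false bn a b c φ φv _ _ _ φv≤ = ineq (lg (1 + c))
    (lg (1 + (a + (b + c)))) (credit bn) φ φv
    (lg-mono (s≤s (≤-trans (m≤n+m c b) (m≤n+m (b + c) a)))) φv≤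
  where
  ineq : ∀ x z r φ φv → x ≤ z → φv ≤ φ + 0 →
    1 + (11 + φv) + 0 + 16 * x ≤ 6 + 6 + φ + r + 16 * z
  ineq x z r φ φv h₁ h₂ = combine r (16 ⊛ h₁ ⊞ h₂)
    (solve (x ∷ z ∷ r ∷ φ ∷ φv ∷ []))
pairing-link true  true  false bn a b c φ φv (inj₁ ())
pairing-link true  true  false bn a b c φ φv (inj₂ ())
pairing-link false false true  bn a b c φ φv (inj₁ ())
pairing-link false false true  bn a b c φ φv (inj₂ ())

linkCost-comm : ∀ b b′ c s → linkCost b b′ c s ≡ linkCost b′ b c s
linkCost-comm true  true  c     s = refl
linkCost-comm true  false true  s = refl
linkCost-comm true  false false s = refl
linkCost-comm false true  true  s = refl
linkCost-comm false true  false s = refl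
linkCost-comm false false c     s = refl

-- The potential that a link adds: b tells whether its winner is temporary,
-- the other arguments describe the loser as in childPotential.
attached : Bool → Bool → ℕ → Bool → ℕ → ℕ
attached true  b s p w = childPotential b s p w
attached false b s p w = 0

attached≤linkCost : ∀ b b′ s p w →
  attached b b′ s p w ≤ linkCost b b′ b (bit b + w + s)
attached≤linkCost true  true  s p w =
  8 ⊛ ≤-reflexive (cong (λ k → lg (1 + k)) (+-comm s w)) ⊞ light≤4 p s w
attached≤linkCost true  false s p w = ≤-refl
attached≤linkCost false b′    s p w = z≤n

-- Set aside during the assembly pass for the link that the current champion
-- takes part in next; p tells whether its leftmost child is permanent.
lead : Bool → Bool → ℕ
lead true  true  = 4
lead true  false = 0
lead false p     = 10

light≤lead : ∀ p s w → light p s w ≤ lead true p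
light≤lead true  s w = light≤4 true s w
light≤lead false s w = z≤n

-- The old champion, of size `w`, joins children of total size `c`. If both roots are temporary, it
-- gets extra potential only when `w ≤ c`, and then `1 + w` at least doubles in the term `4 * lg`.
assembly-winˡ : ∀ b b′ p q c w →
  1 + attached b b′ w p c + lead b (not b′) + 4 * lg (1 + w) ≤
  entry b (bit b + c + w) + lead b′ q + 4 * lg (1 + (bit b + c + w))
assembly-winˡ true true p q c w = ineq (lg (1 + (w + c))) (lg (1 + (1 + c + w)))
    (light p w c) (lg (1 + w)) (lead true q)
    (lg-mono (s≤s (≤-trans (≤-reflexive (+-comm w c)) (n≤1+n (c + w)))))
    (light-upper p w c (s≤s z≤n) (s≤s (m≤n+m w (1 + c)))
      (λ w≤c → s≤s (≤-trans (≤-reflexive (+-suc w w)) (s≤s (+-monoˡ-≤ w w≤c)))))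
  where
  ineq : ∀ x y l u r → x ≤ y → l + 4 * u ≤ 4 * y →
    1 + (8 * x + l) + 0 + 4 * u ≤ 1 + 8 * y + r + 4 * y
  ineq x y l u r h₁ h₂ = combine r (8 ⊛ h₁ ⊞ h₂) (solve (x ∷ y ∷ l ∷ u ∷ r ∷ []))
-- The lead of 10 given up by a permanent champion covers the 6 of the new permanent child and the
-- new lead of 4.
assembly-winˡ true false p q c w = ineq (lg (1 + (1 + c + w))) (lg (1 + w))
    (lg-mono (s≤s (m≤n+m w (1 + c))))
  where
  ineq : ∀ y u → u ≤ y → 11 + 4 * u ≤ 1 + 8 * y + 10 + 4 * y
  ineq y u h = combine (8 * y) (4 ⊛ h) (solve (y ∷ u ∷ []))
assembly-winˡ false b′ p q c w =
  m≤m+n 11 (lead b′ q) ⊞ 4 ⊛ lg-mono (s≤s (m≤n+m w c))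

-- The lead of a temporary champion is just the extra potential that a temporary loser may get. A
-- permanent loser to it spends its entry of 11 as 1 for the link, 6 as a child and 4 on the new
-- lead. A permanent champion keeps its lead.
assembly-winʳ : ∀ b b′ q s d →
  1 + attached b′ b s q d + lead b′ (not b) + 4 * lg (1 + (bit b′ + d)) ≤
  entry b (s + (bit b′ + d)) + lead b′ q + 4 * lg (1 + (s + (bit b′ + d)))
assembly-winʳ true true q s d = ineq (lg (1 + (s + d))) (lg (1 + (s + (1 + d))))
    (light q s d) (lead true q) (lg (1 + (1 + d)))
    (lg-mono (s≤s (+-monoʳ-≤ s (n≤1+n d)))) (light≤lead q s d)
    (lg-mono (s≤s (m≤n+m (1 + d) s)))
  where
  ineq : ∀ x y l r u → x ≤ y → l ≤ r → u ≤ y →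
    1 + (8 * x + l) + 0 + 4 * u ≤ 1 + 8 * y + r + 4 * y
  ineq x y l r u h₁ h₂ h₃ = combine 0 (8 ⊛ h₁ ⊞ h₂ ⊞ 4 ⊛ h₃)
    (solve (x ∷ y ∷ l ∷ r ∷ u ∷ []))
assembly-winʳ false true q s d =
  m≤m+n 11 (lead true q) ⊞ 4 ⊛ lg-mono (s≤s (m≤n+m (1 + d) s))
assembly-winʳ b false q s d =
  +-monoˡ-≤ 10 (1≤entry b) ⊞ 4 ⊛ lg-mono (s≤s (m≤n+m d s))
  where
  1≤entry : ∀ b → 1 ≤ entry b (s + d)
  1≤entry true  = s≤s z≤n
  1≤entry false = s≤s z≤n

-- Additive node weights.

module Weights {a ℓ₁ ℓ₂} (O : TotalOrder a ℓ₁ ℓ₂) (f : Node → ℕ) where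

  open PairingHeap O

  mutual
    -- Temporariness as `f` yields sizes; the indicator of a node as `f` counts its occurrences.
    weight : Tree → ℕ
    weight (node x _ cs) = f x + weight* cs

    weight* : List Tree → ℕ
    weight* []       = 0
    weight* (t ∷ ts) = weight t + weight* ts

  weight*-++ : ∀ ts us → weight* (ts ++ us) ≡ weight* ts + weight* us
  weight*-++ []       us = refl
  weight*-++ (t ∷ ts) us = trans (cong (weight t +_) (weight*-++ ts us))
    (sym (+-assoc (weight t) (weight* ts) (weight* us)))

  weight-link : ∀ {t u v} → Link t u v → weight v ≡ weight t + weight u
  weight-link (winˡ {x} {cs = cs} {y} {ds = ds} _) =
    eq (f x) (weight* cs) (f y) (weight* ds)
    where
    eq : ∀ m n m′ n′ → m + (m′ + n′ + n) ≡ m + n + (m′ + n′)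
    eq m n m′ n′ = solve (m ∷ n ∷ m′ ∷ n′ ∷ [])
  weight-link (winʳ {x} {cs = cs} {y} {ds = ds} _) =
    eq (f x) (weight* cs) (f y) (weight* ds)
    where
    eq : ∀ m n m′ n′ → m′ + (m + n + n′) ≡ m + n + (m′ + n′)
    eq m n m′ n′ = solve (m ∷ n ∷ m′ ∷ n′ ∷ [])

  weight-cut : ∀ {t s t′} → Cut t s t′ → weight t ≡ weight s + weight t′
  weight-cut (child {x} ls {s} rs)
    rewrite weight*-++ ls (s ∷ rs) | weight*-++ ls rs =
      eq (f x) (weight* ls) (weight s) (weight* rs)
    where
    eq : ∀ m n p q → m + (n + (p + q)) ≡ p + (m + (n + q))
    eq m n p q = solve (m ∷ n ∷ p ∷ q ∷ [])
  weight-cut (deeper {x} ls {t} {s} {t′} rs c)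
    rewrite weight*-++ ls (t ∷ rs) | weight*-++ ls (t′ ∷ rs) | weight-cut c =
      eq (f x) (weight* ls) (weight s) (weight t′) (weight* rs)
    where
    eq : ∀ m n p p′ q → m + (n + (p + p′ + q)) ≡ p + (m + (n + (p′ + q)))
    eq m n p p′ q = solve (m ∷ n ∷ p ∷ p′ ∷ q ∷ [])

  weight-pairing : ∀ {ts us n} → PairingPass ts us n → weight* us ≡ weight* ts
  weight-pairing none = refl
  weight-pairing last = refl
  weight-pairing (pair {t} {u} {ts = ts} l p)
    rewrite weight-link l | weight-pairing p = +-assoc (weight t) (weight u) (weight* ts)

  weight-assembly : ∀ {ts t n} → AssemblyPass ts t n → weight t ≡ weight* ts
  weight-assembly (done {t}) = sym (+-identityʳ (weight t))
  weight-assembly (step {t} p l) =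
    trans (weight-link l) (cong (weight t +_) (weight-assembly p))

  heapWeight : Heap → ℕ
  heapWeight nothing  = 0
  heapWeight (just t) = weight t

  weight-combine : ∀ {ts h n} → Combine ts h n → heapWeight h ≡ weight* ts
  weight-combine empty         = refl
  weight-combine (twoPass p q) = trans (weight-assembly q) (weight-pairing p)

  weight-meld : ∀ {h₁ h₂ h} → Meld h₁ h₂ h →
    heapWeight h ≡ heapWeight h₁ + heapWeight h₂
  weight-meld emptyˡ   = refl
  weight-meld emptyʳ   = sym (+-identityʳ _)
  weight-meld (link l) = weight-link l

  weight-decreaseKey : ∀ {t t′} → DecreaseKey t t′ → weight t′ ≡ weight t
  weight-decreaseKey (root _)        = refl
  weight-decreaseKey (nonroot c _ l) = trans (weight-link l) (sym (weight-cut c))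

-- The potential of trees and its change under a link.

module Potential {a ℓ₁ ℓ₂} (O : TotalOrder a ℓ₁ ℓ₂) (τ : Node → Bool) where

  open PairingHeap O
  open Weights O (λ x → bit (τ x)) public
    renaming (weight to temps; weight* to temps*; heapWeight to heapTemps)

  isTemp : Tree → Bool
  isTemp (node x _ _) = τ x

  children : Tree → List Tree
  children (node _ _ cs) = cs

  bit-isTemp≤ : ∀ t → bit (isTemp t) ≤ temps t
  bit-isTemp≤ (node x _ cs) = m≤m+n (bit (τ x)) (temps* cs)

  startsPermanent : List Tree → Bool
  startsPermanent []      = false
  startsPermanent (t ∷ _) = not (isTemp t)

  listPotential : List Tree → ℕ
  listPotential []       = 0
  listPotential (t ∷ ts) =
    childPotential (isTemp t) (temps t) (startsPermanent ts) (temps* ts) +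
    listPotential ts

  rootPotential : Bool → List Tree → ℕ
  rootPotential true  cs = listPotential cs
  rootPotential false cs = 0

  mutual
    potential : Tree → ℕ
    potential (node x _ cs) = rootPotential (τ x) cs + potential* cs

    potential* : List Tree → ℕ
    potential* []       = 0
    potential* (t ∷ ts) = potential t + potential* ts

  potential*-++ : ∀ ts us → potential* (ts ++ us) ≡ potential* ts + potential* us
  potential*-++ []       us = refl
  potential*-++ (t ∷ ts) us = trans (cong (potential t +_) (potential*-++ ts us))
    (sym (+-assoc (potential t) (potential* ts) (potential* us)))

  attachedTo : Tree → Tree → ℕ
  attachedTo t u = attached (isTemp t) (isTemp u) (temps u)
    (startsPermanent (children t)) (temps* (children t))

  rootPotential-∷ : ∀ b u cs → rootPotential b (u ∷ cs) ≡
    attached b (isTemp u) (temps u) (startsPermanent cs) (temps* cs) + rootPotential b cs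
  rootPotential-∷ true  u cs = refl
  rootPotential-∷ false u cs = refl

  potential-attach : ∀ x k cs u → potential (node x k (u ∷ cs)) ≡
    potential (node x k cs) + potential u + attachedTo (node x k cs) u
  potential-attach x k cs u rewrite rootPotential-∷ (τ x) u cs =
    eq (attachedTo (node x k cs) u) (rootPotential (τ x) cs) (potential u) (potential* cs)
    where
    eq : ∀ m n p q → m + n + (p + q) ≡ n + q + p + m
    eq m n p q = solve (m ∷ n ∷ p ∷ q ∷ [])

  potential-link : ∀ {t u v} → Link t u v →
    potential v ≤ potential t + potential u +
                  linkCost (isTemp t) (isTemp u) (isTemp v) (temps t + temps u)
  potential-link (winˡ {x} {k} {cs} {y} {l} {ds} _) = ≤-trans
    (≤-reflexive (potential-attach x k cs (node y l ds)))
    (+-monoʳ-≤ (potential (node x k cs) + potential (node y l ds))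
      (attached≤linkCost (τ x) (τ y) (temps (node y l ds)) (startsPermanent cs) (temps* cs)))
  potential-link (winʳ {x} {k} {cs} {y} {l} {ds} _) = begin
    potential (node y l (t ∷ ds))
      ≡⟨ potential-attach y l ds t ⟩
    potential u + potential t + attachedTo u t
      ≡⟨ cong (_+ attachedTo u t) (+-comm (potential u) (potential t)) ⟩
    potential t + potential u + attachedTo u t
      ≤⟨ +-monoʳ-≤ (potential t + potential u)
           (attached≤linkCost (τ y) (τ x) (temps t) (startsPermanent ds) (temps* ds)) ⟩
    potential t + potential u + linkCost (τ y) (τ x) (τ y) (temps u + temps t)
      ≡⟨ cong (potential t + potential u +_)
           (trans (linkCost-comm (τ y) (τ x) (τ y) (temps u + temps t))
                  (cong (linkCost (τ x) (τ y) (τ y)) (+-comm (temps u) (temps t)))) ⟩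
    potential t + potential u + linkCost (τ x) (τ y) (τ y) (temps t + temps u) ∎
    where
    open ≤-Reasoning
    t = node x k cs
    u = node y l ds

  isTemp-link : ∀ {t u v} → Link t u v → isTemp v ≡ isTemp t ⊎ isTemp v ≡ isTemp u
  isTemp-link (winˡ _) = inj₁ refl
  isTemp-link (winʳ _) = inj₂ refl

  -- The two passes of a deletion.

  entries : List Tree → ℕ
  entries []       = 0
  entries (t ∷ ts) = entry (isTemp t) (temps t + temps* ts) + entries ts

  potential-pairing : ∀ {ts us n} → PairingPass ts us n →
    n + (entries us + potential* us) + credit (startsPermanent ts) ≤
    listPotential ts + potential* ts + 16 * lg (1 + temps* ts) + 5
  potential-pairing none = ≤-trans (m≤m+n 2 3) (m≤n+m 5 _)
  -- The 5 in the bound is what an unpaired permanent root needs: an entry of 11 against its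
  -- potential of 6.
  potential-pairing (last {t}) = alone (isTemp t) (temps t) (potential t + 0)
    where
    ineq : ∀ x φ → 0 + (1 + 8 * x + 0 + φ) + 2 ≤ 8 * x + 0 + 0 + φ + 16 * x + 5
    ineq x φ = combine (2 + 16 * x) (z≤n {0}) (solve (x ∷ φ ∷ []))
    ineq′ : ∀ x φ → 0 + (11 + φ) + 0 ≤ 6 + φ + 16 * x + 5
    ineq′ x φ = combine (16 * x) (z≤n {0}) (solve (x ∷ φ ∷ []))
    alone : ∀ b s φ → 0 + (entry b (s + 0) + 0 + φ) + credit (not b) ≤
      childPotential b s false 0 + 0 + φ + 16 * lg (1 + (s + 0)) + 5
    alone true  s φ = ineq (lg (1 + (s + 0))) φ
    alone false s φ = ineq′ (lg (1 + (s + 0))) φ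
  potential-pairing (pair {t} {u} {v} {ts} {us} {n} l p)
    rewrite weight-link l | weight-pairing p | +-assoc (temps t) (temps u) (temps* ts) =
      ineq n (entry (isTemp v) (temps t + (temps u + temps* ts))) (entries us)
        (potential v) (potential* us) (credit (not (isTemp t)))
        (credit (startsPermanent ts))
        (childPotential (isTemp t) (temps t) (not (isTemp u)) (temps u + temps* ts))
        (childPotential (isTemp u) (temps u) (startsPermanent ts) (temps* ts))
        (listPotential ts) (potential t) (potential u) (potential* ts)
        (lg (1 + temps* ts)) (lg (1 + (temps t + (temps u + temps* ts))))
        (pairing-link (isTemp t) (isTemp u) (isTemp v) (startsPermanent ts)
          (temps t) (temps u) (temps* ts) (potential t + potential u) (potential v)
          (isTemp-link l) (bit-isTemp≤ t) (bit-isTemp≤ u) (potential-link l))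
        (potential-pairing p)
    where
    ineq : ∀ n e es φv φs r r′ g g′ gs φt φu φts x z →
      1 + (e + φv) + r + 16 * x ≤ g + g′ + (φt + φu) + r′ + 16 * z →
      n + (es + φs) + r′ ≤ gs + φts + 16 * x + 5 →
      1 + n + (e + es + (φv + φs)) + r ≤ g + (g′ + gs) + (φt + (φu + φts)) + 16 * z + 5
    ineq n e es φv φs r r′ g g′ gs φt φu φts x z h₁ h₂ = combine 0 (h₁ ⊞ h₂)
      (solve (n ∷ e ∷ es ∷ φv ∷ φs ∷ r ∷ r′ ∷ g ∷ g′ ∷ gs ∷ φt ∷ φu ∷ φts ∷ x ∷ z ∷ []))

  leadOf : Tree → ℕ
  leadOf t = lead (isTemp t) (startsPermanent (children t))

  assembly-link : ∀ {t u v} → Link t u v →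
    1 + (potential v + leadOf v) + 4 * lg (1 + temps u) ≤
    entry (isTemp t) (temps t + temps u) + potential t + (potential u + leadOf u) +
    4 * lg (1 + (temps t + temps u))
  assembly-link (winˡ {x} {k} {cs} {y} {l} {ds} _)
    rewrite potential-attach x k cs (node y l ds) =
      ineq (potential t) (potential u) (attachedTo t u) (lead (τ x) (not (τ y)))
        (entry (τ x) (temps t + temps u)) (leadOf u)
        (lg (1 + temps u)) (lg (1 + (temps t + temps u)))
        (assembly-winˡ (τ x) (τ y) (startsPermanent cs) (startsPermanent ds)
          (temps* cs) (temps u))
    where
    t = node x k cs
    u = node y l ds
    ineq : ∀ φt φu a r e r′ p q → 1 + a + r + 4 * p ≤ e + r′ + 4 * q →
      1 + (φt + φu + a + r) + 4 * p ≤ e + φt + (φu + r′) + 4 * q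
    ineq φt φu a r e r′ p q h = combine 0 h
      (solve (φt ∷ φu ∷ a ∷ r ∷ e ∷ r′ ∷ p ∷ q ∷ []))
  assembly-link (winʳ {x} {k} {cs} {y} {l} {ds} _)
    rewrite potential-attach y l ds (node x k cs) =
      ineq (potential t) (potential u) (attachedTo u t) (lead (τ y) (not (τ x)))
        (entry (τ x) (temps t + temps u)) (leadOf u)
        (lg (1 + temps u)) (lg (1 + (temps t + temps u)))
        (assembly-winʳ (τ x) (τ y) (startsPermanent ds) (temps t) (temps* ds))
    where
    t = node x k cs
    u = node y l ds
    ineq : ∀ φt φu a r e r′ p q → 1 + a + r + 4 * p ≤ e + r′ + 4 * q →
      1 + (φu + φt + a + r) + 4 * p ≤ e + φt + (φu + r′) + 4 * q
    ineq φt φu a r e r′ p q h = combine 0 h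
      (solve (φt ∷ φu ∷ a ∷ r ∷ e ∷ r′ ∷ p ∷ q ∷ []))

  potential-assembly : ∀ {ts t n} → AssemblyPass ts t n →
    n + (potential t + leadOf t) ≤
    entries ts + potential* ts + 4 * lg (1 + temps* ts) + 4
  -- The 4 in the bound provides the lead of a temporary champion whose leftmost child is permanent.
  potential-assembly (done {t}) =
    ineq (potential t) (leadOf t) (entry (isTemp t) (temps t + 0)) (lg (1 + (temps t + 0)))
      (lead≤ (isTemp t) (startsPermanent (children t)) (temps t + 0))
    where
    lead≤ : ∀ b p s → lead b p ≤ entry b s + 4
    lead≤ true  true  s = m≤n+m 4 (1 + 8 * lg (1 + s))
    lead≤ true  false s = z≤n
    lead≤ false p     s = m≤m+n 10 5
    ineq : ∀ φ r e x → r ≤ e + 4 → 0 + (φ + r) ≤ e + 0 + (φ + 0) + 4 * x + 4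
    ineq φ r e x h = combine (4 * x) h (solve (φ ∷ r ∷ e ∷ x ∷ []))
  potential-assembly (step {t} {ts} {u} {v} {n} p l) =
    ineq n (potential v + leadOf v) (potential u + leadOf u)
      (entry (isTemp t) (temps t + temps* ts)) (entries ts) (potential t) (potential* ts)
      (lg (1 + temps* ts)) (lg (1 + (temps t + temps* ts)))
      (subst (λ w → 1 + (potential v + leadOf v) + 4 * lg (1 + w) ≤
                    entry (isTemp t) (temps t + w) + potential t + (potential u + leadOf u) +
                    4 * lg (1 + (temps t + w)))
        (weight-assembly p) (assembly-link l))
      (potential-assembly p)
    where
    ineq : ∀ n a b e es φ φs x y → 1 + a + 4 * x ≤ e + φ + b + 4 * y →
      n + b ≤ es + φs + 4 * x + 4 → 1 + n + a ≤ e + es + (φ + φs) + 4 * y + 4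
    ineq n a b e es φ φs x y h₁ h₂ = combine 0 (h₁ ⊞ h₂)
      (solve (n ∷ a ∷ b ∷ e ∷ es ∷ φ ∷ φs ∷ x ∷ y ∷ []))

  heapPotential : Heap → ℕ
  heapPotential nothing  = 0
  heapPotential (just t) = potential t

  potential-combine : ∀ {ts h n} → Combine ts h n →
    n + heapPotential h ≤ listPotential ts + potential* ts + 20 * lg (1 + temps* ts) + 9
  potential-combine empty = z≤n
  potential-combine (twoPass {ts} {us} {t} {m} {n} p q) =
    ineq m n (entries us + potential* us) (credit (startsPermanent ts))
      (listPotential ts + potential* ts) (potential t) (leadOf t) (lg (1 + temps* ts))
      (potential-pairing p)
      (subst (λ w → n + (potential t + leadOf t) ≤
                    entries us + potential* us + 4 * lg (1 + w) + 4)
        (weight-pairing p) (potential-assembly q))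
    where
    ineq : ∀ m n e r g φ r′ x → m + e + r ≤ g + 16 * x + 5 →
      n + (φ + r′) ≤ e + 4 * x + 4 → m + n + φ ≤ g + 20 * x + 9
    ineq m n e r g φ r′ x h₁ h₂ = combine (r + r′) (h₁ ⊞ h₂)
      (solve (m ∷ n ∷ e ∷ r ∷ g ∷ φ ∷ r′ ∷ x ∷ []))

  -- Cuts and decrease-key.

  startsPermanent-++ : ∀ ls {ts us} → startsPermanent ts ≡ startsPermanent us →
    startsPermanent (ls ++ ts) ≡ startsPermanent (ls ++ us)
  startsPermanent-++ []      eq = eq
  startsPermanent-++ (_ ∷ _) eq = refl

  temps*-mono-++ : ∀ ls {ts us} → temps* ts ≤ temps* us →
    temps* (ls ++ ts) ≤ temps* (ls ++ us)
  temps*-mono-++ []       h = h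
  temps*-mono-++ (l ∷ ls) h = +-monoʳ-≤ (temps l) (temps*-mono-++ ls h)

  -- Siblings further left depend on the changed part only through its total size and the kind of
  -- its first root. The slacks `i` and `j` carry the logarithmic terms of a cut to the front.
  listPotential-++ : ∀ ls {ts us} i j → startsPermanent ts ≡ startsPermanent us →
    temps* ts ≤ temps* us → listPotential ts + i ≤ listPotential us + j →
    listPotential (ls ++ ts) + i ≤ listPotential (ls ++ us) + j
  listPotential-++ []       i j _ _ h = h
  listPotential-++ (l ∷ ls) {ts} {us} i j eq w≤ h
    rewrite startsPermanent-++ ls {ts} {us} eq = assoc-mono
      (childPotential-monoʳ (isTemp l) (temps l) (startsPermanent (ls ++ us))
        (temps*-mono-++ ls w≤))
      (listPotential-++ ls i j eq w≤ h)
    where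
    assoc-mono : ∀ {a b m n i j} → a ≤ b → m + i ≤ n + j → a + m + i ≤ b + n + j
    assoc-mono {a} {b} {m} {n} {i} {j} h₁ h₂ = combine 0 (h₁ ⊞ h₂)
      (solve (a ∷ b ∷ m ∷ n ∷ i ∷ j ∷ []))

  -- Only the sibling just left of `s` gets a new right neighbour and hence possibly extra
  -- potential. For the others the sizes to the right can only decrease.
  listPotential-remove : ∀ ls s rs →
    listPotential (ls ++ rs) ≤ listPotential (ls ++ s ∷ rs) + 4
  listPotential-remove [] s rs =
    ≤-trans (m≤n+m (listPotential rs) _) (m≤m+n _ 4)
  listPotential-remove (l ∷ []) s rs = ineq (listPotential rs)
      (childPotential-change (isTemp l) (temps l) (startsPermanent rs) (startsPermanent (s ∷ rs))
        (m≤n+m (temps* rs) (temps s)))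
    where
    ineq : ∀ {m n o} k → m ≤ n + 4 → m + k ≤ n + (o + k) + 4
    ineq {m} {n} {o} k h = combine o h (solve (m ∷ n ∷ o ∷ k ∷ []))
  listPotential-remove (l ∷ ls@(_ ∷ _)) s rs = ≤-trans
    (+-mono-≤ (childPotential-monoʳ (isTemp l) (temps l) (startsPermanent ls)
                (temps*-mono-++ ls {rs} {s ∷ rs} (m≤n+m (temps* rs) (temps s))))
              (listPotential-remove ls s rs))
    (≤-reflexive (sym (+-assoc
      (childPotential (isTemp l) (temps l) (startsPermanent ls) (temps* (ls ++ s ∷ rs)))
      (listPotential (ls ++ s ∷ rs)) 4)))

  isTemp-cut : ∀ {t s t′} → Cut t s t′ → isTemp t′ ≡ isTemp t
  isTemp-cut (child _ _)    = refl
  isTemp-cut (deeper _ _ _) = refl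

  -- Induction along the path to the cut: the logarithm pays for all ancestors that become light,
  -- since by `childPotential-shrink` each of them raises it. The final 4 is for the left sibling of
  -- `s`.
  potential-cut : ∀ {t s t′} → Cut t s t′ →
    potential s + potential t′ ≤ potential t + 4 * lg (temps t′) + 4
  potential-cut (child {x} {k} ls {s} rs)
    rewrite potential*-++ ls (s ∷ rs) | potential*-++ ls rs =
      ineq (potential s) (potential* ls) (potential* rs)
        (lg (temps (node x k (ls ++ rs)))) (atRoot (τ x))
    where
    atRoot : ∀ b → rootPotential b (ls ++ rs) ≤ rootPotential b (ls ++ s ∷ rs) + 4
    atRoot true  = listPotential-remove ls s rs
    atRoot false = z≤n
    ineq : ∀ {m n} p q r i → m ≤ n + 4 →
      p + (m + (q + r)) ≤ n + (q + (p + r)) + 4 * i + 4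
    ineq {m} {n} p q r i h = combine (4 * i) h
      (solve (m ∷ n ∷ p ∷ q ∷ r ∷ i ∷ []))
  potential-cut (deeper {x} {k} ls {t} {s} {t′} rs c)
    rewrite potential*-++ ls (t ∷ rs) | potential*-++ ls (t′ ∷ rs) =
      ineq (rootPotential (τ x) (ls ++ t′ ∷ rs)) (rootPotential (τ x) (ls ++ t ∷ rs))
        (potential s) (potential* ls) (potential t) (potential t′) (potential* rs)
        (lg (temps t′)) (lg (temps (node x k (ls ++ t′ ∷ rs))))
        (≤-trans (atRoot (τ x)) (+-monoʳ-≤ (rootPotential (τ x) (ls ++ t ∷ rs)) (4 ⊛ lg-mono within)))
        (potential-cut c)
    where
    shrinks : temps t′ ≤ temps t
    shrinks = ≤-trans (m≤n+m (temps t′) (temps s)) (≤-reflexive (sym (weight-cut c)))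
    within : temps t′ + temps* rs ≤ temps (node x k (ls ++ t′ ∷ rs))
    within = ≤-trans (m≤n+m _ (temps* ls))
      (≤-trans (≤-reflexive (sym (weight*-++ ls (t′ ∷ rs)))) (m≤n+m _ (bit (τ x))))
    front : listPotential (t′ ∷ rs) + 4 * lg (temps t′) ≤
            listPotential (t ∷ rs) + 4 * lg (temps t′ + temps* rs)
    front = swap (childPotential (isTemp t′) (temps t′) (startsPermanent rs) (temps* rs))
      (childPotential (isTemp t) (temps t) (startsPermanent rs) (temps* rs))
      (listPotential rs) (4 * lg (temps t′)) (4 * lg (temps t′ + temps* rs))
      (subst (λ b → childPotential (isTemp t′) (temps t′) (startsPermanent rs) (temps* rs) +
                      4 * lg (temps t′) ≤
                    childPotential b (temps t) (startsPermanent rs) (temps* rs) +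
                      4 * lg (temps t′ + temps* rs))
        (isTemp-cut c)
        (childPotential-shrink (isTemp t′) (startsPermanent rs) (bit-isTemp≤ t′) shrinks))
      where
      swap : ∀ m n k i j → m + i ≤ n + j → m + k + i ≤ n + k + j
      swap m n k i j h = combine 0 h (solve (m ∷ n ∷ i ∷ j ∷ k ∷ []))
    atRoot : ∀ b → rootPotential b (ls ++ t′ ∷ rs) + 4 * lg (temps t′) ≤
                 rootPotential b (ls ++ t ∷ rs) + 4 * lg (temps t′ + temps* rs)
    atRoot true  = listPotential-++ ls _ _ (cong not (isTemp-cut c))
      (+-monoˡ-≤ (temps* rs) shrinks) front
    atRoot false = 4 ⊛ lg-mono (m≤m+n (temps t′) (temps* rs))
    ineq : ∀ m n p q r r′ w i j → m + 4 * i ≤ n + 4 * j → p + r′ ≤ r + 4 * i + 4 →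
      p + (m + (q + (r′ + w))) ≤ n + (q + (r + w)) + 4 * j + 4
    ineq m n p q r r′ w i j h₁ h₂ = combine 0 (h₁ ⊞ h₂)
      (solve (m ∷ n ∷ p ∷ q ∷ r ∷ r′ ∷ w ∷ i ∷ j ∷ []))

  linkCost≤ : ∀ b b′ c s → linkCost b b′ c s ≤ 8 * lg s + 6
  linkCost≤ true  true  true  s = +-monoʳ-≤ (8 * lg s) (m≤m+n 4 2)
  linkCost≤ true  true  false s = z≤n
  linkCost≤ true  false true  s = m≤n+m 6 (8 * lg s)
  linkCost≤ true  false false s = z≤n
  linkCost≤ false true  true  s = m≤n+m 6 (8 * lg s)
  linkCost≤ false true  false s = z≤n
  linkCost≤ false false c     s = z≤n

  potential-decreaseKey : ∀ {t t′} → DecreaseKey t t′ →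
    potential t′ ≤ potential t + 12 * lg (temps t) + 10
  potential-decreaseKey (root _) = ≤-trans (m≤m+n _ _) (m≤m+n _ 10)
  potential-decreaseKey (nonroot {t} {x} {k} {k′} {cs} {t′} {u} c _ l) =
    ineq (potential u) (potential s) (potential t′) (potential t)
      (lg (temps t′)) (lg (temps t))
      (≤-trans (potential-link l) (+-monoʳ-≤ (potential s + potential t′)
        (≤-trans (linkCost≤ (isTemp s) (isTemp t′) (isTemp u) (temps s + temps t′))
          (≤-reflexive (cong (λ w → 8 * lg w + 6) (sym (weight-cut c)))))))
      (potential-cut c)
      (lg-mono (≤-trans (m≤n+m (temps t′) (temps s)) (≤-reflexive (sym (weight-cut c)))))
    where
    s = node x k cs
    ineq : ∀ φu φs φt′ φt i j → φu ≤ φs + φt′ + (8 * j + 6) →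
      φs + φt′ ≤ φt + 4 * i + 4 → i ≤ j → φu ≤ φt + 12 * j + 10
    ineq φu φs φt′ φt i j h₁ h₂ h₃ = combine 0 (h₁ ⊞ h₂ ⊞ 4 ⊛ h₃)
      (solve (φu ∷ φs ∷ φt′ ∷ φt ∷ i ∷ j ∷ []))

  -- The debt in melds and deletions.

  -- It is 0 at the end, and until then finances the logarithmic potential
  -- created by the links of insertions and melds.  Only a deletion repays it.
  debt : Heap → ℕ
  debt h = lgFactorial (heapTemps h)

  cheap-debt : ∀ {k} m n → k ≤ 6 →
    k + 8 * (lgFactorial m + lgFactorial n) ≤ 8 * lgFactorial (m + n) + 6
  cheap-debt m n k≤6 = ≤-trans (+-mono-≤ k≤6 (8 ⊛ lgFactorial-+ m n)) (≤-reflexive (+-comm 6 _))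

  -- Only a link of two temporary roots has logarithmic cost, and the top term of
  -- `lgFactorial (m + n)` matches it. For all other links superadditivity and the constant 6
  -- suffice.
  linkCost-debt : ∀ b b′ c m n → bit b ≤ m → bit b′ ≤ n →
    linkCost b b′ c (m + n) + 8 * (lgFactorial m + lgFactorial n) ≤
    8 * lgFactorial (m + n) + 6
  linkCost-debt true true true m n 1≤m 1≤n =
      ineq (lg (m + n)) (lgFactorial m + lgFactorial n) (lgFactorial (m + n))
        (lgFactorial-+⁺ m n 1≤m 1≤n)
    where
    ineq : ∀ x y z → x + y ≤ z → 8 * x + 4 + 8 * y ≤ 8 * z + 6
    ineq x y z h = combine 2 (8 ⊛ h) (solve (x ∷ y ∷ z ∷ []))
  linkCost-debt true  true  false m n _ _ = cheap-debt m n z≤n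
  linkCost-debt true  false true  m n _ _ = cheap-debt m n ≤-refl
  linkCost-debt true  false false m n _ _ = cheap-debt m n z≤n
  linkCost-debt false true  true  m n _ _ = cheap-debt m n ≤-refl
  linkCost-debt false true  false m n _ _ = cheap-debt m n z≤n
  linkCost-debt false false c     m n _ _ = cheap-debt m n z≤n

  potential-meld : ∀ {h₁ h₂ h} → Meld h₁ h₂ h →
    heapPotential h + 8 * (debt h₁ + debt h₂) ≤
    heapPotential h₁ + heapPotential h₂ + 8 * debt h + 6
  potential-meld emptyˡ = m≤m+n _ 6
  potential-meld (emptyʳ {h}) = ineq (heapPotential h) (debt h)
    where
    ineq : ∀ φ x → φ + 8 * (x + 0) ≤ φ + 0 + 8 * x + 6
    ineq φ x = combine 6 (z≤n {0}) (solve (φ ∷ x ∷ []))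
  potential-meld (link {t} {u} {v} l) rewrite weight-link l =
    ineq (potential v) (potential t + potential u)
      (linkCost (isTemp t) (isTemp u) (isTemp v) (temps t + temps u))
      (lgFactorial (temps t) + lgFactorial (temps u)) (lgFactorial (temps t + temps u))
      (potential-link l)
      (linkCost-debt (isTemp t) (isTemp u) (isTemp v) (temps t) (temps u)
        (bit-isTemp≤ t) (bit-isTemp≤ u))
    where
    ineq : ∀ φ ψ k x y → φ ≤ ψ + k → k + 8 * x ≤ 8 * y + 6 →
      φ + 8 * x ≤ ψ + 8 * y + 6
    ineq φ ψ k x y h₁ h₂ = combine 0 (h₁ ⊞ h₂) (solve (φ ∷ ψ ∷ k ∷ x ∷ y ∷ []))

  potential-delete : ∀ {x k cs h n} → τ x ≡ true → Combine cs h n →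
    n + heapPotential h ≤
    potential (node x k cs) + 20 * lg (temps (node x k cs)) + 9
  potential-delete temp c rewrite temp = potential-combine c

  debt-delete : ∀ {x k cs h n} → τ x ≡ true → Combine cs h n →
    debt (just (node x k cs)) ≡ lg (temps (node x k cs)) + debt h
  debt-delete temp c rewrite temp | weight-combine c = refl

  temps≡length : ∀ {p} {P : Pred Node p} (P? : Decidable P) → (∀ x → τ x ≡ does (P? x)) →
    ∀ t → temps t ≡ length (filter P? (nodes t))
  temps≡length P? τ≡ = one
    where
    mutual
      one : ∀ t → temps t ≡ length (filter P? (nodes t))
      one (node x _ cs) rewrite τ≡ x with does (P? x)
      ... | true  = cong suc (many cs)
      ... | false = many cs

      many : ∀ ts → temps* ts ≡ length (filter P? (nodes* ts))
      many []       = refl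
      many (t ∷ ts) rewrite filter-++ P? (nodes t) (nodes* ts)
                          | length-++ (filter P? (nodes t)) {filter P? (nodes* ts)} =
        cong₂ _+_ (one t) (many ts)

-- Counting the occurrences of a node.

indicator : Node → Node → ℕ
indicator x y = bit (does (x ≟ y))

indicator-refl : ∀ x → indicator x x ≡ 1
indicator-refl x = cong bit (dec-true (x ≟ x) refl)

indicator-≢ : ∀ {x y} → x ≢ y → indicator x y ≡ 0
indicator-≢ {x} {y} x≢y = cong bit (dec-false (x ≟ y) x≢y)

∈⇒1≤count : ∀ {x xs} → x ∈ xs → 1 ≤ sum (map (indicator x) xs)
∈⇒1≤count {x} (here refl) = ≤-trans (≤-reflexive (sym (indicator-refl x))) (m≤m+n _ _)
∈⇒1≤count (there x∈xs)    = ≤-trans (∈⇒1≤count x∈xs) (m≤n+m _ _)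

module Executions {a ℓ₁ ℓ₂} (O : TotalOrder a ℓ₁ ℓ₂) where

  open PairingHeap O
  open State

  total* : (Heap → ℕ) → List Heap → ℕ
  total* g hs = sum (map g hs)

  total*-↭ : ∀ g {hs hs′} → hs ↭ hs′ → total* g hs ≡ total* g hs′
  total*-↭ g p = sum-↭ (map⁺ g p)

  inserted : ∀ {s s′} → Execution s s′ → List Node
  inserted ε                             = []
  inserted (insert {f = x} _ _ _ ◅ σs)   = x ∷ inserted σs
  inserted (makeHeap ◅ σs)               = inserted σs
  inserted (findMin _ ◅ σs)              = inserted σs
  inserted (meld _ _ ◅ σs)               = inserted σs
  inserted (decreaseKey _ _ ◅ σs)        = inserted σs
  inserted (deleteMin _ _ ◅ σs)          = inserted σs

  inserted-fresh : ∀ {x s s′} (σs : Execution s s′) → x < fresh s →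
    sum (map (indicator x) (inserted σs)) ≡ 0
  inserted-fresh ε                        x<f = refl
  inserted-fresh (makeHeap ◅ σs)          x<f = inserted-fresh σs x<f
  inserted-fresh (findMin _ ◅ σs)         x<f = inserted-fresh σs x<f
  inserted-fresh (insert _ _ _ ◅ σs)      x<f =
    cong₂ _+_ (indicator-≢ (<⇒≢ x<f)) (inserted-fresh σs (m<n⇒m<1+n x<f))
  inserted-fresh (meld _ _ ◅ σs)          x<f = inserted-fresh σs x<f
  inserted-fresh (decreaseKey _ _ ◅ σs)   x<f = inserted-fresh σs x<f
  inserted-fresh (deleteMin _ _ ◅ σs)     x<f = inserted-fresh σs x<f

  inserted-once : ∀ x {s s′} (σs : Execution s s′) →
    sum (map (indicator x) (inserted σs)) ≤ 1
  inserted-once x ε                        = z≤n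
  inserted-once x (makeHeap ◅ σs)          = inserted-once x σs
  inserted-once x (findMin _ ◅ σs)         = inserted-once x σs
  inserted-once x (insert {f = y} _ _ _ ◅ σs) with x ≟ y
  ... | yes refl = ≤-reflexive (cong₂ _+_ (indicator-refl x) (inserted-fresh σs ≤-refl))
  ... | no x≢y   = ≤-trans (≤-reflexive (cong (_+ sum (map (indicator x) (inserted σs))) (indicator-≢ x≢y)))
                           (inserted-once x σs)
  inserted-once x (meld _ _ ◅ σs)          = inserted-once x σs
  inserted-once x (decreaseKey _ _ ◅ σs)   = inserted-once x σs
  inserted-once x (deleteMin _ _ ◅ σs)     = inserted-once x σs

  module _ (f : Node → ℕ) where

    open Weights O f

    weight-execution : ∀ {s s′} (σs : Execution s s′) →
      total* heapWeight (heaps s′) + sum (map f (deleted σs)) ≡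
      total* heapWeight (heaps s) + sum (map f (inserted σs))
    weight-execution ε                = refl
    weight-execution (makeHeap ◅ σs)  = weight-execution σs
    weight-execution (findMin _ ◅ σs) = weight-execution σs
    weight-execution (insert {x} {h = h} {hs′ = hs} _ p m ◅ σs)
      rewrite total*-↭ heapWeight p = trans (weight-execution σs) (trans
        (cong (λ w → w + total* heapWeight hs + sum (map f (inserted σs))) (weight-meld m))
        (eq (f x) (heapWeight h) (total* heapWeight hs) (sum (map f (inserted σs)))))
      where
      eq : ∀ m n p q → m + 0 + n + p + q ≡ n + p + (m + q)
      eq m n p q = solve (m ∷ n ∷ p ∷ q ∷ [])
    weight-execution (meld {h₁ = h₁} {h₂} {hs′ = hs} p m ◅ σs)
      rewrite total*-↭ heapWeight p = trans (weight-execution σs) (cong (_+ sum (map f (inserted σs)))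
        (trans (cong (_+ total* heapWeight hs) (weight-meld m))
               (+-assoc (heapWeight h₁) (heapWeight h₂) (total* heapWeight hs))))
    weight-execution (decreaseKey {hs′ = hs} p d ◅ σs)
      rewrite total*-↭ heapWeight p = trans (weight-execution σs)
        (cong (λ w → w + total* heapWeight hs + sum (map f (inserted σs)))
          (weight-decreaseKey d))
    weight-execution {s′ = s′} (deleteMin {x = x} {cs = cs} {hs′ = hs} p c ◅ σs)
      rewrite total*-↭ heapWeight p =
        eq (total* heapWeight (heaps s′)) (f x) (sum (map f (deleted σs)))
          (weight* cs) (total* heapWeight hs) (sum (map f (inserted σs)))
          (trans (weight-execution σs)
            (cong (λ w → w + total* heapWeight hs + sum (map f (inserted σs)))
              (weight-combine c)))
      where
      eq : ∀ m n d p q r → m + d ≡ p + q + r → m + (n + d) ≡ n + p + q + r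
      eq m n d p q r e = begin
        m + (n + d)      ≡⟨ solve (m ∷ n ∷ d ∷ []) ⟩
        n + (m + d)      ≡⟨ cong (n +_) e ⟩
        n + (p + q + r)  ≡⟨ solve (n ∷ p ∷ q ∷ r ∷ []) ⟩
        n + p + q + r    ∎
        where open ≡-Reasoning

  -- Final occurrences and deletions of `x` together number its insertions, of which there is at
  -- most one. A deletion uses that one up.
  deleted-gone : ∀ {x s} (σs : Execution initial s) → x ∈ deleted σs →
    total* (Weights.heapWeight O (indicator x)) (heaps s) ≡ 0
  deleted-gone {x} σs x∈ = n≤0⇒n≡0 (+-cancelʳ-≤ 1 _ 0 (≤-trans
    (+-monoʳ-≤ _ (∈⇒1≤count x∈))
    (≤-trans (≤-reflexive (weight-execution (indicator x) σs)) (inserted-once x σs))))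

  module _ (τ : Node → Bool) where

    open Potential O τ

    mutual
      temps≡0 : ∀ t → (∀ x → τ x ≡ true → Weights.weight O (indicator x) t ≡ 0) → temps t ≡ 0
      temps≡0 (node x _ cs) gone with τ x in temp
      ... | true  = ⊥-elim (1+n≢0 (trans (sym (indicator-refl x)) (m+n≡0⇒m≡0 _ (gone x temp))))
      ... | false = temps*≡0 cs (λ y temp′ → m+n≡0⇒n≡0 (indicator y x) (gone y temp′))

      temps*≡0 : ∀ ts → (∀ x → τ x ≡ true → Weights.weight* O (indicator x) ts ≡ 0) →
        temps* ts ≡ 0
      temps*≡0 []       gone = refl
      temps*≡0 (t ∷ ts) gone = cong₂ _+_
        (temps≡0 t (λ x temp → m+n≡0⇒m≡0 _ (gone x temp)))
        (temps*≡0 ts (λ x temp → m+n≡0⇒n≡0 (Weights.weight O (indicator x) t) (gone x temp)))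

    debt≡0 : ∀ hs →
      (∀ x → τ x ≡ true → total* (Weights.heapWeight O (indicator x)) hs ≡ 0) →
      total* debt hs ≡ 0
    debt≡0 []             gone = refl
    debt≡0 (nothing ∷ hs) gone = debt≡0 hs gone
    debt≡0 (just t ∷ hs)  gone = cong₂ _+_
      (cong lgFactorial (temps≡0 t (λ x temp → m+n≡0⇒m≡0 _ (gone x temp))))
      (debt≡0 hs (λ x temp → m+n≡0⇒n≡0 (Weights.weight O (indicator x) t) (gone x temp)))

  -- Amortized analysis relative to a fixed sequence.

  module _ {s₀ s₁} (ρ : Execution s₀ s₁) where

    open Potential O (λ x → does (temporary? ρ x))

    -- The 7 per heap pays for the meld that makes the heap vanish.
    statePotential : List Heap → ℕ
    statePotential = total* (λ h → 7 + heapPotential h)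

    stateDebt : List Heap → ℕ
    stateDebt = total* debt

    charge : ∀ {s s′} → Step s s′ → ℕ
    charge σ = isInsert σ + isMakeHeapOrFindMin σ + logSize ρ σ

    lg-temps≤ : ∀ t → lg (temps t) ≤ ⌊log₂ size ρ t ⌋
    lg-temps≤ t = begin
      lg (temps t)       ≡⟨ cong lg (temps≡length (temporary? ρ) (λ _ → refl) t) ⟩
      lg n               ≡⟨ lg≡⌊log₂⌋ n ⟩
      ⌊log₂ n ⌋          ≤⟨ ⌊log₂⌋-mono-≤ (m≤n⊔m 4 n) ⟩
      ⌊log₂ size ρ t ⌋   ∎
      where
      open ≤-Reasoning
      n = length (filter (temporary? ρ) (nodes t))

    -- Lets additive constants be charged to the logarithm.
    2≤logSize : ∀ t → 2 ≤ ⌊log₂ size ρ t ⌋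
    2≤logSize t = ⌊log₂⌋-mono-≤ (m≤m⊔n 4 (length (filter (temporary? ρ) (nodes t))))

    -- Temporariness refers to the fixed `ρ`, so the hypothesis is what makes the node deleted by
    -- `σ` temporary. The debt counts negatively, hence its exchanged sides.
    amortized-step : ∀ {s s′} (σ : Step s s′) → (∀ {x} → x ∈ deleted (σ ◅ ε) → x ∈ deleted ρ) →
      maxTime 1 σ + statePotential (heaps s′) + 8 * stateDebt (heaps s) ≤
      statePotential (heaps s) + 8 * stateDebt (heaps s′) + 33 * charge σ
    amortized-step (makeHeap {hs = hs}) _ = ineq (statePotential hs) (stateDebt hs)
      where
      ineq : ∀ φ d → 1 + (7 + φ) + 8 * d ≤ φ + 8 * d + 33
      ineq φ d = combine 25 (z≤n {0}) (solve (φ ∷ d ∷ []))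
    amortized-step (findMin {hs = hs} _) _ = ineq (statePotential hs) (stateDebt hs)
      where
      ineq : ∀ φ d → 1 + φ + 8 * d ≤ φ + 8 * d + 33
      ineq φ d = combine 32 (z≤n {0}) (solve (φ ∷ d ∷ []))
    amortized-step (insert {f} {h = h} {h′} {hs} k p m) _
      rewrite total*-↭ (λ h → 7 + heapPotential h) p | total*-↭ debt p =
        ineq (potential (node f k [])) (heapPotential h) (heapPotential h′) (statePotential hs)
          (debt (just (node f k []))) (debt h) (debt h′) (stateDebt hs)
          (singleton (does (temporary? ρ f))) (potential-meld m)
      where
      singleton : ∀ b → rootPotential b [] + 0 ≤ 0
      singleton true  = z≤n
      singleton false = z≤n
      ineq : ∀ φ₀ φ φ′ φs d₀ d d′ ds → φ₀ ≤ 0 →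
        φ′ + 8 * (d₀ + d) ≤ φ₀ + φ + 8 * d′ + 6 →
        1 + (7 + φ′ + φs) + 8 * (d + ds) ≤ 7 + φ + φs + 8 * (d′ + ds) + 33
      ineq φ₀ φ φ′ φs d₀ d d′ ds h₁ h₂ = combine (8 * d₀ + 26) (h₁ ⊞ h₂)
        (solve (φ₀ ∷ φ ∷ φ′ ∷ φs ∷ d₀ ∷ d ∷ d′ ∷ ds ∷ []))
    amortized-step (meld {h₁ = h₁} {h₂} {h} {hs} p m) _
      rewrite total*-↭ (λ h → 7 + heapPotential h) p | total*-↭ debt p =
        ineq (heapPotential h₁) (heapPotential h₂) (heapPotential h) (statePotential hs)
          (debt h₁) (debt h₂) (debt h) (stateDebt hs) (potential-meld m)
      where
      ineq : ∀ φ₁ φ₂ φ φs d₁ d₂ d ds → φ + 8 * (d₁ + d₂) ≤ φ₁ + φ₂ + 8 * d + 6 →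
        1 + (7 + φ + φs) + 8 * (d₁ + (d₂ + ds)) ≤ 7 + φ₁ + (7 + φ₂ + φs) + 8 * (d + ds) + 0
      ineq φ₁ φ₂ φ φs d₁ d₂ d ds h = combine 0 h
        (solve (φ₁ ∷ φ₂ ∷ φ ∷ φs ∷ d₁ ∷ d₂ ∷ d ∷ ds ∷ []))
    amortized-step (decreaseKey {t = t} {t′} {hs} p d) _
      rewrite total*-↭ (λ h → 7 + heapPotential h) p | total*-↭ debt p | weight-decreaseKey d =
        ineq (potential t) (potential t′) (statePotential hs) (debt (just t)) (stateDebt hs)
          (lg (temps t)) ⌊log₂ size ρ t ⌋
          (potential-decreaseKey d) (lg-temps≤ t) (2≤logSize t)
      where
      ineq : ∀ φ φ′ φs d ds l L → φ′ ≤ φ + 12 * l + 10 → l ≤ L → 2 ≤ L →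
        1 + (7 + φ′ + φs) + 8 * (d + ds) ≤ 7 + φ + φs + 8 * (d + ds) + 33 * L
      ineq φ φ′ φs d ds l L h₁ h₂ h₃ = combine (15 * L + 1) (h₁ ⊞ 12 ⊛ h₂ ⊞ 6 ⊛ h₃)
        (solve (φ ∷ φ′ ∷ φs ∷ d ∷ ds ∷ l ∷ L ∷ []))
    amortized-step (deleteMin {x = x} {k} {cs} {h} {n} {hs} p c) del
      rewrite total*-↭ (λ h → 7 + heapPotential h) p | total*-↭ debt p =
        ineq n (potential t) (heapPotential h) (statePotential hs)
          (debt (just t)) (debt h) (stateDebt hs) (lg (temps t)) ⌊log₂ size ρ t ⌋
          (potential-delete {k = k} temp c) (≤-reflexive (debt-delete {k = k} temp c))
          (lg-temps≤ t) (2≤logSize t)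
      where
      t = node x k cs
      temp : does (temporary? ρ x) ≡ true
      temp = dec-true (temporary? ρ x) (del (here refl))
      -- This case determines the 33: 20 for the two passes, 8 for the repaid debt, and 5 because
      -- the constant 10 is at most `5 * L`.
      ineq : ∀ n φ φ′ φs d d′ ds l L → n + φ′ ≤ φ + 20 * l + 9 → d ≤ l + d′ →
        l ≤ L → 2 ≤ L →
        1 + 1 * n + (7 + φ′ + φs) + 8 * (d + ds) ≤ 7 + φ + φs + 8 * (d′ + ds) + 33 * L
      ineq n φ φ′ φs d d′ ds l L h₁ h₂ h₃ h₄ = combine 0 (h₁ ⊞ 8 ⊛ h₂ ⊞ 28 ⊛ h₃ ⊞ 5 ⊛ h₄)
        (solve (n ∷ φ ∷ φ′ ∷ φs ∷ d ∷ d′ ∷ ds ∷ l ∷ L ∷ []))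

    deleted-head : ∀ {s s′ s″ x} (σ : Step s s′) (σs : Execution s′ s″) →
      x ∈ deleted (σ ◅ ε) → x ∈ deleted (σ ◅ σs)
    deleted-head (deleteMin _ _) σs (here x≡) = here x≡

    deleted-tail : ∀ {s s′ s″ x} (σ : Step s s′) (σs : Execution s′ s″) →
      x ∈ deleted σs → x ∈ deleted (σ ◅ σs)
    deleted-tail makeHeap          σs x∈ = x∈
    deleted-tail (findMin _)       σs x∈ = x∈
    deleted-tail (insert _ _ _)    σs x∈ = x∈
    deleted-tail (meld _ _)        σs x∈ = x∈
    deleted-tail (decreaseKey _ _) σs x∈ = x∈
    deleted-tail (deleteMin _ _)   σs x∈ = there x∈

    amortized : ∀ {s s′} (σs : Execution s s′) → (∀ {x} → x ∈ deleted σs → x ∈ deleted ρ) →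
      total (maxTime 1) σs + statePotential (heaps s′) + 8 * stateDebt (heaps s) ≤
      statePotential (heaps s) + 8 * stateDebt (heaps s′) +
      33 * (total isInsert σs + total isMakeHeapOrFindMin σs + total (logSize ρ) σs)
    amortized {s} ε _ = ≤-reflexive (sym (+-identityʳ _))
    amortized {s} {s″} (_◅_ {j = s′} σ σs) del =
      ineq (maxTime 1 σ) (total (maxTime 1) σs)
        (statePotential (heaps s)) (statePotential (heaps s′)) (statePotential (heaps s″))
        (stateDebt (heaps s)) (stateDebt (heaps s′)) (stateDebt (heaps s″))
        (isInsert σ) (isMakeHeapOrFindMin σ) (logSize ρ σ)
        (total isInsert σs) (total isMakeHeapOrFindMin σs) (total (logSize ρ) σs)
        (amortized-step σ (λ x∈ → del (deleted-head σ σs x∈)))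
        (amortized σs (λ x∈ → del (deleted-tail σ σs x∈)))
      where
      ineq : ∀ m ms φ φ′ φ″ d d′ d″ i f l is fs ls →
        m + φ′ + 8 * d ≤ φ + 8 * d′ + 33 * (i + f + l) →
        ms + φ″ + 8 * d′ ≤ φ′ + 8 * d″ + 33 * (is + fs + ls) →
        m + ms + φ″ + 8 * d ≤ φ + 8 * d″ + 33 * (i + is + (f + fs) + (l + ls))
      ineq m ms φ φ′ φ″ d d′ d″ i f l is fs ls h₁ h₂ = combine 0 (h₁ ⊞ h₂)
        (solve (m ∷ ms ∷ φ ∷ φ′ ∷ φ″ ∷ d ∷ d′ ∷ d″ ∷ i ∷ f ∷ l ∷ is ∷ fs ∷ ls ∷ []))

  -- The total time.

  temporary-sound : ∀ {s s′} (ρ : Execution s s′) x → does (temporary? ρ x) ≡ true → x ∈ deleted ρ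
  temporary-sound ρ x eq with temporary? ρ x
  ... | yes x∈ = x∈

  total-maxTime≤ : ∀ {s} (ρ : Execution initial s) → total (maxTime 1) ρ ≤
    33 * (total isInsert ρ + total isMakeHeapOrFindMin ρ + total (logSize ρ) ρ)
  -- Potential and debt of the empty initial collection compute to 0. The final debt vanishes
  -- because every temporary node has been deleted.
  total-maxTime≤ {s} ρ = ≤-trans (≤-trans (m≤m+n _ _) (m≤m+n _ _)) (subst
    (λ d → total (maxTime 1) ρ + statePotential ρ (heaps s) + 0 ≤ 8 * d +
      33 * (total isInsert ρ + total isMakeHeapOrFindMin ρ + total (logSize ρ) ρ))
    (debt≡0 _ (heaps s) (λ x temp → deleted-gone ρ (temporary-sound ρ x temp)))
    (amortized ρ ρ (λ x∈ → x∈)))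

  -- Linearity in `b` reduces the bound to unit costs.
  maxTime-* : ∀ b {s s′} (σ : Step s s′) → maxTime b σ ≡ b * maxTime 1 σ
  maxTime-* b makeHeap                = sym (*-identityʳ b)
  maxTime-* b (findMin _)             = sym (*-identityʳ b)
  maxTime-* b (insert _ _ _)          = sym (*-identityʳ b)
  maxTime-* b (meld _ _)              = sym (*-identityʳ b)
  maxTime-* b (decreaseKey _ _)       = sym (*-identityʳ b)
  maxTime-* b (deleteMin {n = n} _ _) = eq b n
    where
    eq : ∀ b n → b + b * n ≡ b * (1 + 1 * n)
    eq b n = solve (b ∷ n ∷ [])

  total-time≤ : ∀ b (time : ∀ {s s′} → Step s s′ → ℕ) → CostModel b time →
    ∀ {s s′} (σs : Execution s s′) → total time σs ≤ b * total (maxTime 1) σs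
  total-time≤ b time model ε = z≤n
  total-time≤ b time model (σ ◅ σs) = ≤-trans
    (+-mono-≤ (≤-trans (model σ) (≤-reflexive (maxTime-* b σ))) (total-time≤ b time model σs))
    (≤-reflexive (sym (*-distribˡ-+ b (maxTime 1 σ) (total (maxTime 1) σs))))

corollary11 : ∀ {a ℓ₁ ℓ₂} (b : ℕ) → ∃[ c ] ((O : TotalOrder a ℓ₁ ℓ₂) → let open PairingHeap O in
    (time : ∀ {s s′} → Step s s′ → ℕ) → CostModel b time →
    ∀ {s} (σs : Execution initial s) →
    total time σs ≤ c * (total isInsert σs + total isMakeHeapOrFindMin σs + total (logSize σs) σs))
corollary11 b = b * 33 , λ O time model σs → ≤-trans
  (Executions.total-time≤ O b time model σs)
  (≤-trans (*-monoʳ-≤ b (Executions.total-maxTime≤ O σs)) (≤-reflexive (sym (*-assoc b 33 _))))
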